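{- (Church–Rosser, up to $\alpha$-conversion.) (i) For all terms $M,N,P\in\Lambda$, if $M\twoheadrightarrow_\beta N$ and $M\twoheadrightarrow_\beta P$, then there exist terms $Q_1,Q_2$ such that $N\twoheadrightarrow_\beta Q_1$, $P\twoheadrightarrow_\beta Q_2$ and $Q_1\sim_\alpha Q_2$. (ii) For all terms $M,N\in\Lambda$, if $M\simeq_\beta N$, then there exist terms $P_1,P_2$ such that $M\twoheadrightarrow_\beta P_1$, $N\twoheadrightarrow_\beta P_2$ and $P_1\sim_\alpha P_2$.
   Context: Syntax. Fix a type $\mathcal C$ of constants and a countably infinite type $\mathcal V$ of variables with decidable equality and a fixed enumeration. Raw terms $\Lambda$ (NOT identified up to $\alpha$) are given by $M,N,A,B::= c \mid x \mid \lambda[x:A]M \mid \Pi[x:A]B \mid M\cdot N$ with $c\in\mathcal C$, $x\in\mathcal V$. $\mathrm{fv}(M)$ is the (finite list of) free variables, where $\lambda[x:A]M$ and $\Pi[x:A]M$ bind $x$ in $M$ but not in $A$; $\mathrm{fv}(M)-x$ is $\mathrm{fv}(M)$ with $x$ removed. $\equiv$ is syntactic identity. Substitution (Stoughton). A substitution is a function $\sigma:\mathcal V\to\Lambda$; $\iota$ is the identity substitution; $(\sigma,x:=N)$ maps $x$ to $N$ and any other $y$ to $\sigma y$. For a finite list $xs$ of variables, $X(\sigma,xs)$ is the first variable (in the enumeration) not occurring free in $\sigma y$ for any $y\in xs$. Define $c\bullet\sigma=c$, $x\bullet\sigma=\sigma x$, $(M\cdot N)\bullet\sigma=(M\bullet\sigma)\cdot(N\bullet\sigma)$,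 and for $Q\in\{\lambda,\Pi\}$, $(Q[x:A]M)\bullet\sigma=Q[y:A\bullet\sigma](M\bullet(\sigma,x:=y))$ where $y=X(\sigma,\mathrm{fv}(M)-x)$. Write $M[x:=N]$ for $M\bullet(\iota,x:=N)$. $\alpha$-conversion $\sim_\alpha$ is inductively defined by: $c\sim_\alpha c$; $x\sim_\alpha x$; if $M\sim_\alpha M'$ and $N\sim_\alpha N'$ then $M\cdot N\sim_\alpha M'\cdot N'$; for $Q\in\{\lambda,\Pi\}$, if $A\sim_\alpha A'$ and $M[x:=y]\equiv M'[x':=y]$ for some $y\notin\mathrm{fv}(M)-x$, $y\notin\mathrm{fv}(M')-x'$, then $Q[x:A]M\sim_\alpha Q[x':A']M'$. $\beta$-reduction. $\to_\beta$ is the contextual closure (under both positions of application, and both the domain and the body of $\lambda$ and $\Pi$) of the contraction $(\lambda[x:A]M)\cdot N\triangleright_\beta M[x:=N]$. $\twoheadrightarrow_\beta$ is the reflexive-transitive closure of $\to_\beta$ (no $\alpha$-steps). $\simeq_\beta$ is the least equivalence relation containing $\sim_\alpha$ and $\to_\beta$. -}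

module Defs where

open import Data.List.Base using (List; []; [_]; _++_; map; concatMap; filter)
open import Data.List.Extrema.Nat using (max; xs≤max)
open import Data.List.Membership.Propositional using (_∈_; _∉_)
open import Data.List.Membership.Propositional.Properties using (∈-map⁺)
import Data.List.Membership.DecPropositional as DecMembership
import Data.List.Relation.Unary.All as All
open import Data.Nat.Base using (ℕ; zero; suc; _<_; _≤_; s≤s⁻¹)
open import Data.Nat.Properties using (1+n≰n)
open import Data.Product.Base using (∃; _×_; _,_; proj₁)
open import Function.Base using (_∘_)
open import Function.Bundles using (_↔_; Inverse)
open import Level using (Level; _⊔_)
open import Relation.Binary.Construct.Closure.Equivalence using (EqClosure)
open import Relation.Binary.Construct.Closure.ReflexiveTransitive using (Star)
open import Relation.Binary.Construct.Union using (_∪_)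
open import Relation.Binary.Core using (Rel)
open import Relation.Binary.Definitions using (DecidableEquality)
open import Relation.Binary.PropositionalEquality using (_≡_; subst)
open import Relation.Nullary.Decidable using (yes; no; ¬?)
open import Relation.Nullary.Negation using (¬_; contradiction)
open import Relation.Unary using (Pred; Decidable)

least : ∀ {p} {P : Pred ℕ p} → Decidable P → (b : ℕ) → P b →
        ∃ λ n → P n × (∀ m → m < n → ¬ P m)
least P? zero    pb = zero , pb , λ _ ()
least P? (suc b) pb with P? zero
... | yes p₀ = zero , p₀ , λ _ ()
... | no ¬p₀ with least (P? ∘ suc) b pb
...   | n , pn , below = suc n , pn , λ where
          zero    _       → ¬p₀
          (suc m) 1+m<1+n → below m (s≤s⁻¹ 1+m<1+n)

-- `enum` makes V countably infinite and is also the fixed enumeration that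
-- determines which fresh variable substitution picks.
module Calculus {c v : Level} (C : Set c) (V : Set v)
                (_≟_ : DecidableEquality V) (enum : ℕ ↔ V) where

  open DecMembership _≟_ using (_∉?_)
  open Inverse enum using () renaming (to to nth; from to index; strictlyInverseʳ to index-nth)

  infixr 5 _[_∶_]_
  infixl 6 _•_
  infixl 7 _·_ _-_
  infixl 8 _[_:=_]
  infix  4 _∼α_ _▷β_ _→β_ _↠β_ _≃β_

  data Binder : Set where
    ƛ Π : Binder

  data Λ : Set (c ⊔ v) where
    con     : C → Λ
    var     : V → Λ
    _[_∶_]_ : Binder → V → Λ → Λ → Λ
    _·_     : Λ → Λ → Λ

  _-_ : List V → V → List V
  xs - x = filter (λ y → ¬? (y ≟ x)) xs

  fv : Λ → List V
  fv (con k)         = []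
  fv (var x)         = [ x ]
  fv (Q [ x ∶ A ] M) = fv A ++ (fv M - x)
  fv (M · N)         = fv M ++ fv N

  firstNotIn : (xs : List V) →
               ∃ λ n → nth n ∉ xs × (∀ m → m < n → ¬ (nth m ∉ xs))
  firstNotIn xs = least (λ n → nth n ∉? xs) (suc bound) nth-fresh
    where
    bound : ℕ
    bound = max 0 (map index xs)

    nth-fresh : nth (suc bound) ∉ xs
    nth-fresh ∈xs = contradiction
      (subst (_≤ bound) (index-nth (suc bound))
        (All.lookup (xs≤max 0 (map index xs)) (∈-map⁺ index ∈xs)))
      1+n≰n

  Subst : Set (c ⊔ v)
  Subst = V → Λ

  ι : Subst
  ι = var

  _,_:=_ : Subst → V → Λ → Subst
  (σ , x := N) y with y ≟ x
  ... | yes _ = N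
  ... | no  _ = σ y

  -- The first variable in the enumeration not free in σ y for any y ∈ xs.
  X : Subst → List V → V
  X σ xs = nth (proj₁ (firstNotIn (concatMap (fv ∘ σ) xs)))

  _•_ : Λ → Subst → Λ
  con k           • σ = con k
  var x           • σ = σ x
  (M · N)         • σ = (M • σ) · (N • σ)
  (Q [ x ∶ A ] M) • σ = Q [ y ∶ A • σ ] (M • (σ , x := var y))
    where
    y : V
    y = X σ (fv M - x)

  _[_:=_] : Λ → V → Λ → Λ
  M [ x := N ] = M • (ι , x := N)

  -- Terms are raw, so _≡_ on Λ is syntactic identity.
  data _∼α_ : Rel Λ (c ⊔ v) where
    con  : ∀ {k} → con k ∼α con k
    var  : ∀ {x} → var x ∼α var x
    app  : ∀ {M M′ N N′} → M ∼α M′ → N ∼α N′ → M · N ∼α M′ · N′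
    bind : ∀ {Q x x′ A A′ M M′} y →
           A ∼α A′ →
           y ∉ fv M - x → y ∉ fv M′ - x′ →
           M [ x := var y ] ≡ M′ [ x′ := var y ] →
           (Q [ x ∶ A ] M) ∼α (Q [ x′ ∶ A′ ] M′)

  data ContextualClosure {r} (R : Rel Λ r) : Rel Λ (c ⊔ v ⊔ r) where
    step   : ∀ {M N} → R M N → ContextualClosure R M N
    appˡ   : ∀ {M M′ N} → ContextualClosure R M M′ →
             ContextualClosure R (M · N) (M′ · N)
    appʳ   : ∀ {M N N′} → ContextualClosure R N N′ →
             ContextualClosure R (M · N) (M · N′)
    domain : ∀ {Q x A A′ M} → ContextualClosure R A A′ →
             ContextualClosure R (Q [ x ∶ A ] M) (Q [ x ∶ A′ ] M)
    body   : ∀ {Q x A M M′} → ContextualClosure R M M′ →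
             ContextualClosure R (Q [ x ∶ A ] M) (Q [ x ∶ A ] M′)

  data _▷β_ : Rel Λ (c ⊔ v) where
    β : ∀ {x A M N} → (ƛ [ x ∶ A ] M) · N ▷β M [ x := N ]

  _→β_ : Rel Λ (c ⊔ v)
  _→β_ = ContextualClosure _▷β_

  _↠β_ : Rel Λ (c ⊔ v)
  _↠β_ = Star _→β_

  _≃β_ : Rel Λ (c ⊔ v)
  _≃β_ = EqClosure (_∼α_ ∪ _→β_)

{-# OPTIONS --safe #-}

-- Interpret raw terms in de Bruijn terms whose variables range over a type I, a binder passing
-- from I to Maybe I. Stoughton's substitution becomes de Bruijn substitution, two raw terms are
-- α-convertible iff their interpretations are equal, and every parallel reduction out of an
-- interpretation is the image of a β-reduction of the raw term. Confluence up to α therefore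
-- follows from the diamond property of parallel reduction on de Bruijn terms.

module Submission where

open import Defs
open import Data.List.Base using (concatMap; _++_)
open import Data.List.Membership.Propositional using (_∈_; _∉_; find; lose)
open import Data.List.Membership.Propositional.Properties
  using (∈-++⁺ˡ; ∈-++⁺ʳ; ∈-++⁻; ∈-filter⁺; ∈-filter⁻; ∈-concatMap⁺; ∈-concatMap⁻)
open import Data.List.Relation.Unary.Any using (here)
open import Data.Maybe.Base using (Maybe; just; nothing; maybe′) renaming (map to mapᵐ)
open import Data.Maybe.Properties using (just-injective)
open import Data.Nat.Base using (ℕ)
open import Data.Nat.Properties using (<-cmp)
open import Data.Product.Base using (∃; ∃₂; _×_; _,_; proj₁; proj₂)
open import Data.Sum.Base using (inj₁; inj₂)
open import Function.Base using (id; _∘_)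
open import Function.Bundles using (_↔_; Inverse)
open import Level using (Level; _⊔_)
open import Relation.Binary.Construct.Closure.Equivalence as EqClosure using ()
open import Relation.Binary.Construct.Closure.Equivalence.Properties using (a—↠b&a—↠c⇒b↔c)
open import Relation.Binary.Construct.Closure.ReflexiveTransitive as Star
  using (Star; ε; _◅_; _◅◅_)
open import Relation.Binary.Core using (Rel)
open import Relation.Binary.Definitions using (DecidableEquality; tri<; tri≈; tri>)
open import Relation.Binary.PropositionalEquality
  using (_≡_; _≢_; _≗_; refl; sym; trans; cong; cong₂; subst; module ≡-Reasoning)
open import Relation.Binary.Rewriting using (Confluent)
open import Relation.Binary.Structures using (IsEquivalence)
open import Relation.Nullary.Decidable using (yes; no; ¬?)
open import Relation.Nullary.Negation using (contradiction)

-- Abstract rewriting: confluence from the diamond property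

module _ {a ℓ} {A : Set a} {_⟶_ : Rel A ℓ} where

  Diamond : Set (a ⊔ ℓ)
  Diamond = ∀ {t u w} → t ⟶ u → t ⟶ w → ∃ λ z → u ⟶ z × w ⟶ z

  -- Tiling with diamonds carries the step across the whole sequence, and it stays a single step.
  -- This lets `diamond⇒confluent` proceed by induction on the other sequence.
  diamond⇒strip : Diamond → ∀ {t u w} → t ⟶ u → Star _⟶_ t w →
                  ∃ λ z → Star _⟶_ u z × w ⟶ z
  diamond⇒strip ◇ p ε = _ , ε , p
  diamond⇒strip ◇ p (q ◅ qs) with ◇ p q
  ... | _ , p′ , q′ with diamond⇒strip ◇ q′ qs
  ...   | _ , ps , r = _ , p′ ◅ ps , r

  diamond⇒confluent : Diamond → Confluent _⟶_
  diamond⇒confluent ◇ ε qs = _ , qs , ε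
  diamond⇒confluent ◇ (p ◅ ps) qs with diamond⇒strip ◇ p qs
  ... | _ , qs′ , p′ with diamond⇒confluent ◇ ps qs′
  ...   | _ , rs , ss = _ , rs , p′ ◅ ss

module ChurchRosser {c v : Level} (C : Set c) (V : Set v)
                    (_≟_ : DecidableEquality V) (enum : ℕ ↔ V) where

  open Calculus C V _≟_ enum
  open Inverse enum using () renaming (to to nth)

  private variable
    I J K : Set v

  -- De Bruijn terms

  -- Since the type of variables is arbitrary, `I = V` with the environment `id` keeps the free
  -- names of a raw term while its bound names disappear.
  data Tm (I : Set v) : Set (c ⊔ v) where
    conᵈ  : C → Tm I
    varᵈ  : I → Tm I
    bindᵈ : Binder → Tm I → Tm (Maybe I) → Tm I
    appᵈ  : Tm I → Tm I → Tm I

  rename : (I → J) → Tm I → Tm J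
  rename f (conᵈ k)      = conᵈ k
  rename f (varᵈ x)      = varᵈ (f x)
  rename f (bindᵈ Q A M) = bindᵈ Q (rename f A) (rename (mapᵐ f) M)
  rename f (appᵈ M N)    = appᵈ (rename f M) (rename f N)

  lift : (I → Tm J) → Maybe I → Tm (Maybe J)
  lift s = maybe′ (rename just ∘ s) (varᵈ nothing)

  sub : (I → Tm J) → Tm I → Tm J
  sub s (conᵈ k)      = conᵈ k
  sub s (varᵈ x)      = s x
  sub s (bindᵈ Q A M) = bindᵈ Q (sub s A) (sub (lift s) M)
  sub s (appᵈ M N)    = appᵈ (sub s M) (sub s N)

  point : Tm I → Maybe I → Tm I
  point = maybe′ varᵈ

  -- The composition laws take the composite as a pointwise equation: this way they go under
  -- binders without function extensionality.

  rename-rename : {f : I → J} {g : J → K} {h : I → K} → (∀ x → g (f x) ≡ h x) →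
                  ∀ t → rename g (rename f t) ≡ rename h t
  rename-rename gf≗h (conᵈ k)      = refl
  rename-rename gf≗h (varᵈ x)      = cong varᵈ (gf≗h x)
  rename-rename gf≗h (bindᵈ Q A M) = cong₂ (bindᵈ Q) (rename-rename gf≗h A) (rename-rename (λ where
    nothing  → refl
    (just x) → cong just (gf≗h x)) M)
  rename-rename gf≗h (appᵈ M N)    = cong₂ appᵈ (rename-rename gf≗h M) (rename-rename gf≗h N)

  sub-rename : {f : I → J} {s : J → Tm K} {r : I → Tm K} → (∀ x → s (f x) ≡ r x) →
               ∀ t → sub s (rename f t) ≡ sub r t
  sub-rename sf≗r (conᵈ k)      = refl
  sub-rename sf≗r (varᵈ x)      = sf≗r x
  sub-rename sf≗r (bindᵈ Q A M) = cong₂ (bindᵈ Q) (sub-rename sf≗r A) (sub-rename (λ where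
    nothing  → refl
    (just x) → cong (rename just) (sf≗r x)) M)
  sub-rename sf≗r (appᵈ M N)    = cong₂ appᵈ (sub-rename sf≗r M) (sub-rename sf≗r N)

  rename-just-map : (f : I → J) (t : Tm I) →
                    rename (mapᵐ f) (rename just t) ≡ rename just (rename f t)
  rename-just-map f t = trans (rename-rename (λ _ → refl) t) (sym (rename-rename (λ _ → refl) t))

  rename-sub : {s : I → Tm J} {f : J → K} {r : I → Tm K} → (∀ x → rename f (s x) ≡ r x) →
               ∀ t → rename f (sub s t) ≡ sub r t
  rename-sub fs≗r (conᵈ k)      = refl
  rename-sub fs≗r (varᵈ x)      = fs≗r x
  rename-sub {s = s} {f} fs≗r (bindᵈ Q A M) =
    cong₂ (bindᵈ Q) (rename-sub fs≗r A) (rename-sub (λ where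
      nothing  → refl
      (just x) → trans (rename-just-map f (s x)) (cong (rename just) (fs≗r x))) M)
  rename-sub fs≗r (appᵈ M N)    = cong₂ appᵈ (rename-sub fs≗r M) (rename-sub fs≗r N)

  sub-lift-just : (s : I → Tm J) (t : Tm I) → sub (lift s) (rename just t) ≡ rename just (sub s t)
  sub-lift-just s t = trans (sub-rename (λ _ → refl) t) (sym (rename-sub (λ _ → refl) t))

  sub-sub : {s : I → Tm J} {s′ : J → Tm K} {r : I → Tm K} → (∀ x → sub s′ (s x) ≡ r x) →
            ∀ t → sub s′ (sub s t) ≡ sub r t
  sub-sub s′s≗r (conᵈ k)      = refl
  sub-sub s′s≗r (varᵈ x)      = s′s≗r x
  sub-sub {s = s} {s′} s′s≗r (bindᵈ Q A M) =
    cong₂ (bindᵈ Q) (sub-sub s′s≗r A) (sub-sub (λ where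
      nothing  → refl
      (just x) → trans (sub-lift-just s′ (s x)) (cong (rename just) (s′s≗r x))) M)
  sub-sub s′s≗r (appᵈ M N)    = cong₂ appᵈ (sub-sub s′s≗r M) (sub-sub s′s≗r N)

  sub-var : {s : I → Tm I} → s ≗ varᵈ → ∀ t → sub s t ≡ t
  sub-var s≗var (conᵈ k)      = refl
  sub-var s≗var (varᵈ x)      = s≗var x
  sub-var s≗var (bindᵈ Q A M) = cong₂ (bindᵈ Q) (sub-var s≗var A) (sub-var (λ where
    nothing  → refl
    (just x) → cong (rename just) (s≗var x)) M)
  sub-var s≗var (appᵈ M N)    = cong₂ appᵈ (sub-var s≗var M) (sub-var s≗var N)

  rename-point : (f : I → J) (M : Tm (Maybe I)) (N : Tm I) →
                 sub (point (rename f N)) (rename (mapᵐ f) M) ≡ rename f (sub (point N) M)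
  rename-point f M N = trans
    (sub-rename (λ where nothing → refl ; (just x) → refl) M)
    (sym (rename-sub {r = rename f ∘ point N} (λ _ → refl) M))

  -- The substitution lemma: both sides fuse into the substitution `sub s ∘ point N`. At `just x`
  -- the weakening introduced by `lift` is undone by `point`.
  sub-point : (s : I → Tm J) (M : Tm (Maybe I)) (N : Tm I) →
              sub (point (sub s N)) (sub (lift s) M) ≡ sub s (sub (point N) M)
  sub-point s M N = trans
    (sub-sub (λ where
      nothing  → refl
      (just x) → trans (sub-rename (λ _ → refl) (s x)) (sub-var (λ _ → refl) (s x))) M)
    (sym (sub-sub {r = sub s ∘ point N} (λ _ → refl) M))

  -- Parallel reduction

  infix 4 _⇛_

  data _⇛_ {I : Set v} : Rel (Tm I) (c ⊔ v) where
    ⇛con  : ∀ {k} → conᵈ k ⇛ conᵈ k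
    ⇛var  : ∀ {x} → varᵈ x ⇛ varᵈ x
    ⇛bind : ∀ {Q A A′ M M′} → A ⇛ A′ → M ⇛ M′ → bindᵈ Q A M ⇛ bindᵈ Q A′ M′
    ⇛app  : ∀ {M M′ N N′} → M ⇛ M′ → N ⇛ N′ → appᵈ M N ⇛ appᵈ M′ N′
    ⇛β    : ∀ {A M M′ N N′} → M ⇛ M′ → N ⇛ N′ →
            appᵈ (bindᵈ ƛ A M) N ⇛ sub (point N′) M′

  ⇛-refl : (t : Tm I) → t ⇛ t
  ⇛-refl (conᵈ k)      = ⇛con
  ⇛-refl (varᵈ x)      = ⇛var
  ⇛-refl (bindᵈ Q A M) = ⇛bind (⇛-refl A) (⇛-refl M)
  ⇛-refl (appᵈ M N)    = ⇛app (⇛-refl M) (⇛-refl N)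

  ⇛-rename : (f : I → J) {t u : Tm I} → t ⇛ u → rename f t ⇛ rename f u
  ⇛-rename f ⇛con        = ⇛con
  ⇛-rename f ⇛var        = ⇛var
  ⇛-rename f (⇛bind p q) = ⇛bind (⇛-rename f p) (⇛-rename (mapᵐ f) q)
  ⇛-rename f (⇛app p q)  = ⇛app (⇛-rename f p) (⇛-rename f q)
  ⇛-rename f (⇛β {M′ = M′} {N′ = N′} p q) =
    subst (_ ⇛_) (rename-point f M′ N′) (⇛β (⇛-rename (mapᵐ f) p) (⇛-rename f q))

  ⇛-lift : {s s′ : I → Tm J} → (∀ x → s x ⇛ s′ x) → ∀ x → lift s x ⇛ lift s′ x
  ⇛-lift s⇛s′ nothing  = ⇛var
  ⇛-lift s⇛s′ (just x) = ⇛-rename just (s⇛s′ x)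

  ⇛-sub : {s s′ : I → Tm J} → (∀ x → s x ⇛ s′ x) → ∀ {t u} → t ⇛ u → sub s t ⇛ sub s′ u
  ⇛-sub s⇛s′ ⇛con        = ⇛con
  ⇛-sub s⇛s′ ⇛var        = s⇛s′ _
  ⇛-sub s⇛s′ (⇛bind p q) = ⇛bind (⇛-sub s⇛s′ p) (⇛-sub (⇛-lift s⇛s′) q)
  ⇛-sub s⇛s′ (⇛app p q)  = ⇛app (⇛-sub s⇛s′ p) (⇛-sub s⇛s′ q)
  ⇛-sub {s′ = s′} s⇛s′ (⇛β {M′ = M′} {N′ = N′} p q) =
    subst (_ ⇛_) (sub-point s′ M′ N′) (⇛β (⇛-sub (⇛-lift s⇛s′) p) (⇛-sub s⇛s′ q))

  ⇛-sub-point : ∀ {M M′ : Tm (Maybe I)} {N N′} → M ⇛ M′ → N ⇛ N′ →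
                sub (point N) M ⇛ sub (point N′) M′
  ⇛-sub-point p q = ⇛-sub (λ where nothing → q ; (just x) → ⇛var) p

  -- Case analysis on the two derivations. The critical cases set a contraction against steps inside
  -- the same redex: the uncontracted side is closed by contracting, the contracted side by
  -- `⇛-sub-point`.
  ⇛-diamond : Diamond {_⟶_ = _⇛_ {I}}
  ⇛-diamond ⇛con ⇛con = _ , ⇛con , ⇛con
  ⇛-diamond ⇛var ⇛var = _ , ⇛var , ⇛var
  ⇛-diamond (⇛bind p q) (⇛bind p′ q′) with ⇛-diamond p p′ | ⇛-diamond q q′
  ... | _ , a , a′ | _ , b , b′ = _ , ⇛bind a b , ⇛bind a′ b′
  ⇛-diamond (⇛app p q) (⇛app p′ q′) with ⇛-diamond p p′ | ⇛-diamond q q′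
  ... | _ , a , a′ | _ , b , b′ = _ , ⇛app a b , ⇛app a′ b′
  -- The step in the domain is dropped, as contraction erases the domain.
  ⇛-diamond (⇛app (⇛bind _ p) q) (⇛β p′ q′) with ⇛-diamond p p′ | ⇛-diamond q q′
  ... | _ , a , a′ | _ , b , b′ = _ , ⇛β a b , ⇛-sub-point a′ b′
  ⇛-diamond (⇛β p q) (⇛app (⇛bind _ p′) q′) with ⇛-diamond p p′ | ⇛-diamond q q′
  ... | _ , a , a′ | _ , b , b′ = _ , ⇛-sub-point a b , ⇛β a′ b′
  ⇛-diamond (⇛β p q) (⇛β p′ q′) with ⇛-diamond p p′ | ⇛-diamond q q′
  ... | _ , a , a′ | _ , b , b′ = _ , ⇛-sub-point a b , ⇛-sub-point a′ b′

  -- Free variables and fresh names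

  ∈-remove⁺ : ∀ {x z xs} → z ∈ xs → z ≢ x → z ∈ xs - x
  ∈-remove⁺ {x} = ∈-filter⁺ (λ y → ¬? (y ≟ x))

  ∈-remove⁻ : ∀ {x z xs} → z ∈ xs - x → z ∈ xs × z ≢ x
  ∈-remove⁻ {x} = ∈-filter⁻ (λ y → ¬? (y ≟ x))

  ∈-fv-body : ∀ Q {x z} A M → z ∈ fv M → z ≢ x → z ∈ fv (Q [ x ∶ A ] M)
  ∈-fv-body Q A M z∈M z≢x = ∈-++⁺ʳ (fv A) (∈-remove⁺ z∈M z≢x)

  -- Minimality on both sides: if one index were smaller, it would be fresh for the other list as
  -- well, below that list's least fresh index.
  firstNotIn-cong : ∀ {xs ys} → (∀ {z} → z ∈ xs → z ∈ ys) → (∀ {z} → z ∈ ys → z ∈ xs) →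
                    proj₁ (firstNotIn xs) ≡ proj₁ (firstNotIn ys)
  firstNotIn-cong {xs} {ys} xs⊆ys ys⊆xs with firstNotIn xs | firstNotIn ys
  ... | m , m∉xs , m-least | n , n∉ys , n-least with <-cmp m n
  ...   | tri< m<n _ _ = contradiction (m∉xs ∘ ys⊆xs) (n-least m m<n)
  ...   | tri≈ _ m≡n _ = m≡n
  ...   | tri> _ _ n<m = contradiction (n∉ys ∘ xs⊆ys) (m-least n n<m)

  X-fresh : ∀ (σ : Subst) {z xs} → z ∈ xs → X σ xs ∉ fv (σ z)
  X-fresh σ {xs = xs} z∈xs y∈σz =
    proj₁ (proj₂ (firstNotIn (concatMap (fv ∘ σ) xs))) (∈-concatMap⁺ (fv ∘ σ) (lose z∈xs y∈σz))

  concatMap-fv-mono : ∀ {σ σ′ : Subst} {xs xs′} →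
                      (∀ {z} → z ∈ xs → ∃ λ z′ → z′ ∈ xs′ × σ z ≡ σ′ z′) →
                      ∀ {w} → w ∈ concatMap (fv ∘ σ) xs → w ∈ concatMap (fv ∘ σ′) xs′
  concatMap-fv-mono {σ} {σ′} xs⊑xs′ w∈ with find (∈-concatMap⁻ (fv ∘ σ) w∈)
  ... | z , z∈xs , w∈σz with xs⊑xs′ z∈xs
  ...   | z′ , z′∈xs′ , σz≡σ′z′ =
          ∈-concatMap⁺ (fv ∘ σ′) (lose z′∈xs′ (subst (λ t → _ ∈ fv t) σz≡σ′z′ w∈σz))

  -- `X` sees only the set of names free in the images. Matching images instead of variables covers
  -- lists that differ by a renaming, as happens for α-convertible terms.
  X-cong : ∀ {σ σ′ : Subst} {xs xs′} →
           (∀ {z} → z ∈ xs → ∃ λ z′ → z′ ∈ xs′ × σ z ≡ σ′ z′) →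
           (∀ {z′} → z′ ∈ xs′ → ∃ λ z → z ∈ xs × σ′ z′ ≡ σ z) →
           X σ xs ≡ X σ′ xs′
  X-cong ⊑ ⊒ = cong nth (firstNotIn-cong (concatMap-fv-mono ⊑) (concatMap-fv-mono ⊒))

  -- Interpretation of raw terms

  -- Comparing names resolves shadowing: the innermost binder of `x` wins.
  _▸_ : (V → I) → V → V → Maybe I
  (ρ ▸ x) z with z ≟ x
  ... | yes _ = nothing
  ... | no  _ = just (ρ z)

  ⟦_⟧ : Λ → (V → I) → Tm I
  ⟦ con k ⟧         ρ = conᵈ k
  ⟦ var x ⟧         ρ = varᵈ (ρ x)
  ⟦ Q [ x ∶ A ] M ⟧ ρ = bindᵈ Q (⟦ A ⟧ ρ) (⟦ M ⟧ (ρ ▸ x))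
  ⟦ M · N ⟧         ρ = appᵈ (⟦ M ⟧ ρ) (⟦ N ⟧ ρ)

  ▸-new : ∀ (ρ : V → I) x → (ρ ▸ x) x ≡ nothing
  ▸-new ρ x with x ≟ x
  ... | yes _  = refl
  ... | no x≢x = contradiction refl x≢x

  ▸-old : ∀ (ρ : V → I) {x z} → z ≢ x → (ρ ▸ x) z ≡ just (ρ z)
  ▸-old ρ {x} {z} z≢x with z ≟ x
  ... | yes z≡x = contradiction z≡x z≢x
  ... | no _    = refl

  rename-⟦⟧ : ∀ {f : I → J} {ρ ρ′} M → (∀ {z} → z ∈ fv M → f (ρ z) ≡ ρ′ z) →
              rename f (⟦ M ⟧ ρ) ≡ ⟦ M ⟧ ρ′
  rename-⟦⟧ (con k) h = refl
  rename-⟦⟧ (var x) h = cong varᵈ (h (here refl))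
  rename-⟦⟧ {f = f} {ρ} {ρ′} (Q [ x ∶ A ] M) h =
    cong₂ (bindᵈ Q) (rename-⟦⟧ A (h ∘ ∈-++⁺ˡ)) (rename-⟦⟧ M under)
    where
    under : ∀ {z} → z ∈ fv M → mapᵐ f ((ρ ▸ x) z) ≡ (ρ′ ▸ x) z
    under {z} z∈M with z ≟ x
    ... | yes _  = refl
    ... | no z≢x = cong just (h (∈-fv-body Q A M z∈M z≢x))
  rename-⟦⟧ (M · N) h = cong₂ appᵈ (rename-⟦⟧ M (h ∘ ∈-++⁺ˡ)) (rename-⟦⟧ N (h ∘ ∈-++⁺ʳ (fv M)))

  -- Stoughton's substitution is de Bruijn substitution. The hypothesis is confined to free
  -- variables because a chosen bound name is fresh only for the images of those.
  ⟦⟧-• : ∀ {ρ : V → I} {ρ′ : V → J} {σ : Subst} {s} M →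
         (∀ {z} → z ∈ fv M → s (ρ z) ≡ ⟦ σ z ⟧ ρ′) →
         sub s (⟦ M ⟧ ρ) ≡ ⟦ M • σ ⟧ ρ′
  ⟦⟧-• (con k) h = refl
  ⟦⟧-• (var x) h = h (here refl)
  ⟦⟧-• {ρ = ρ} {ρ′} {σ} {s} (Q [ x ∶ A ] M) h =
    cong₂ (bindᵈ Q) (⟦⟧-• A (h ∘ ∈-++⁺ˡ)) (⟦⟧-• M under)
    where
    y : V
    y = X σ (fv M - x)

    under : ∀ {z} → z ∈ fv M → lift s ((ρ ▸ x) z) ≡ ⟦ (σ , x := var y) z ⟧ (ρ′ ▸ y)
    under {z} z∈M with z ≟ x
    ... | yes _  = cong varᵈ (sym (▸-new ρ′ y))
    ... | no z≢x = begin
      rename just (s (ρ z))     ≡⟨ cong (rename just) (h (∈-fv-body Q A M z∈M z≢x)) ⟩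
      -- The new name `y` is not free in `σ z`, so on `σ z` extending the environment by `y` is mere
      -- weakening.
      rename just (⟦ σ z ⟧ ρ′)  ≡⟨ rename-⟦⟧ (σ z) (λ w∈σz → sym (▸-old ρ′ (λ where
                                     refl → X-fresh σ (∈-remove⁺ z∈M z≢x) w∈σz))) ⟩
      ⟦ σ z ⟧ (ρ′ ▸ y)          ∎
      where open ≡-Reasoning
  ⟦⟧-• (M · N) h = cong₂ appᵈ (⟦⟧-• M (h ∘ ∈-++⁺ˡ)) (⟦⟧-• N (h ∘ ∈-++⁺ʳ (fv M)))

  ⟦⟧-[:=] : ∀ (ρ : V → I) x M N → sub (point (⟦ N ⟧ ρ)) (⟦ M ⟧ (ρ ▸ x)) ≡ ⟦ M [ x := N ] ⟧ ρ
  ⟦⟧-[:=] ρ x M N = ⟦⟧-• M λ {z} _ → pointwise z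
    where
    pointwise : ∀ z → point (⟦ N ⟧ ρ) ((ρ ▸ x) z) ≡ ⟦ (ι , x := N) z ⟧ ρ
    pointwise z with z ≟ x
    ... | yes _ = refl
    ... | no  _ = refl

  ⟦⟧-rename-bound : ∀ (ρ : V → I) {x y} M → y ∉ fv M - x →
                    ⟦ M ⟧ (ρ ▸ x) ≡ ⟦ M [ x := var y ] ⟧ (ρ ▸ y)
  -- Renaming a bound name corresponds to the identity substitution `varᵈ`.
  ⟦⟧-rename-bound ρ {x} {y} M y∉ = trans (sym (sub-var (λ _ → refl) _)) (⟦⟧-• M pointwise)
    where
    pointwise : ∀ {z} → z ∈ fv M → varᵈ ((ρ ▸ x) z) ≡ ⟦ (ι , x := var y) z ⟧ (ρ ▸ y)
    pointwise {z} z∈M with z ≟ x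
    ... | yes _  = cong varᵈ (sym (▸-new ρ y))
    ... | no z≢x = cong varᵈ (sym (▸-old ρ λ where refl → y∉ (∈-remove⁺ z∈M z≢x)))

  -- α-conversion is equality of interpretations

  ∼α⇒⟦⟧≡ : ∀ {M N} → M ∼α N → (ρ : V → I) → ⟦ M ⟧ ρ ≡ ⟦ N ⟧ ρ
  ∼α⇒⟦⟧≡ con       ρ = refl
  ∼α⇒⟦⟧≡ var       ρ = refl
  ∼α⇒⟦⟧≡ (app p q) ρ = cong₂ appᵈ (∼α⇒⟦⟧≡ p ρ) (∼α⇒⟦⟧≡ q ρ)
  ∼α⇒⟦⟧≡ (bind {x = x} {x′} {M = M} {M′} y p y∉M y∉M′ M[y]≡M′[y]) ρ =
    cong₂ (bindᵈ _) (∼α⇒⟦⟧≡ p ρ) (begin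
      ⟦ M ⟧ (ρ ▸ x)                     ≡⟨ ⟦⟧-rename-bound ρ M y∉M ⟩
      ⟦ M [ x := var y ] ⟧ (ρ ▸ y)      ≡⟨ cong (λ t → ⟦ t ⟧ (ρ ▸ y)) M[y]≡M′[y] ⟩
      ⟦ M′ [ x′ := var y ] ⟧ (ρ ▸ y)    ≡⟨ ⟦⟧-rename-bound ρ M′ y∉M′ ⟨
      ⟦ M′ ⟧ (ρ ▸ x′)                   ∎)
    where open ≡-Reasoning

  varᵈ-injective : ∀ {x y : I} → varᵈ x ≡ varᵈ y → x ≡ y
  varᵈ-injective refl = refl

  conᵈ-injective : ∀ {k l} → conᵈ {I} k ≡ conᵈ l → k ≡ l
  conᵈ-injective refl = refl

  bindᵈ-injective : ∀ {Q Q′} {A A′ : Tm I} {M M′} → bindᵈ Q A M ≡ bindᵈ Q′ A′ M′ →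
                    Q ≡ Q′ × A ≡ A′ × M ≡ M′
  bindᵈ-injective refl = refl , refl , refl

  appᵈ-injective : ∀ {M M′ N N′ : Tm I} → appᵈ M N ≡ appᵈ M′ N′ → M ≡ M′ × N ≡ N′
  appᵈ-injective refl = refl , refl

  -- `nothing` is never a `just`, so a variable other than the bound one can only match another such
  -- variable.
  ▸-cancel : ∀ {ρ ρ′ : V → I} {x x′ z z′} → z ≢ x → (ρ ▸ x) z ≡ (ρ′ ▸ x′) z′ →
             z′ ≢ x′ × ρ z ≡ ρ′ z′
  ▸-cancel {x = x} {x′} {z} {z′} z≢x eq with z ≟ x | z′ ≟ x′
  ... | yes z≡x | _        = contradiction z≡x z≢x
  ... | no _    | no z′≢x′ = z′≢x′ , just-injective eq
  ... | no _    | yes _    with () ← eq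

  -- Two environments are needed because the bound names of the two terms may differ. The
  -- correspondence of free variables supplies the hypotheses of `X-cong`.
  fv-⟦⟧ : ∀ {ρ ρ′ : V → I} M M′ → ⟦ M ⟧ ρ ≡ ⟦ M′ ⟧ ρ′ →
          ∀ {z} → z ∈ fv M → ∃ λ z′ → z′ ∈ fv M′ × ρ z ≡ ρ′ z′
  fv-remove-⟦⟧ : ∀ {ρ ρ′ : V → I} {x x′} M M′ → ⟦ M ⟧ (ρ ▸ x) ≡ ⟦ M′ ⟧ (ρ′ ▸ x′) →
                 ∀ {z} → z ∈ fv M - x → ∃ λ z′ → z′ ∈ fv M′ - x′ × ρ z ≡ ρ′ z′

  fv-⟦⟧ (var x) (var x′) eq (here refl) = x′ , here refl , varᵈ-injective eq
  fv-⟦⟧ (Q [ x ∶ A ] M) (Q′ [ x′ ∶ A′ ] M′) eq z∈ with bindᵈ-injective eq | ∈-++⁻ (fv A) z∈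
  ... | _ , A≡ , _ | inj₁ z∈A with fv-⟦⟧ A A′ A≡ z∈A
  ...   | z′ , z′∈ , ρz≡ = z′ , ∈-++⁺ˡ z′∈ , ρz≡
  fv-⟦⟧ (Q [ x ∶ A ] M) (Q′ [ x′ ∶ A′ ] M′) eq z∈
      | _ , _ , M≡ | inj₂ z∈M with fv-remove-⟦⟧ M M′ M≡ z∈M
  ...   | z′ , z′∈ , ρz≡ = z′ , ∈-++⁺ʳ (fv A′) z′∈ , ρz≡
  fv-⟦⟧ (M · N) (M′ · N′) eq z∈ with appᵈ-injective eq | ∈-++⁻ (fv M) z∈
  ... | M≡ , _ | inj₁ z∈M with fv-⟦⟧ M M′ M≡ z∈M
  ...   | z′ , z′∈ , ρz≡ = z′ , ∈-++⁺ˡ z′∈ , ρz≡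
  fv-⟦⟧ (M · N) (M′ · N′) eq z∈
      | _ , N≡ | inj₂ z∈N with fv-⟦⟧ N N′ N≡ z∈N
  ...   | z′ , z′∈ , ρz≡ = z′ , ∈-++⁺ʳ (fv M′) z′∈ , ρz≡

  fv-remove-⟦⟧ M M′ M≡ z∈ with ∈-remove⁻ z∈
  ... | z∈M , z≢x with fv-⟦⟧ M M′ M≡ z∈M
  ...   | z′ , z′∈M′ , ρz≡ with ▸-cancel z≢x ρz≡
  ...     | z′≢x′ , ρz≡ρ′z′ = z′ , ∈-remove⁺ z′∈M′ z′≢x′ , ρz≡ρ′z′

  -- Bound variables match only each other, and both are sent to `t`; every other matching pair
  -- falls to the hypothesis.
  ,:=-agree : ∀ {ρ ρ′ : V → I} {σ σ′ : Subst} {x x′ z z′} t →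
              (z ≢ x → z′ ≢ x′ → ρ z ≡ ρ′ z′ → σ z ≡ σ′ z′) →
              (ρ ▸ x) z ≡ (ρ′ ▸ x′) z′ → (σ , x := t) z ≡ (σ′ , x′ := t) z′
  ,:=-agree {x = x} {x′} {z} {z′} t h eq with z ≟ x | z′ ≟ x′
  ... | yes _  | yes _    = refl
  ... | no z≢x | no z′≢x′ = h z≢x z′≢x′ (just-injective eq)
  ... | yes _  | no _     with () ← eq
  ,:=-agree t h eq | no _ | yes _ with () ← eq

  -- Stoughton's substitution depends only on the α-class: the bound name is chosen from the
  -- images of the free variables alone.
  ⟦⟧≡⇒•≡ : ∀ {ρ ρ′ : V → I} {σ σ′ : Subst} M M′ → ⟦ M ⟧ ρ ≡ ⟦ M′ ⟧ ρ′ →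
           (∀ {z z′} → z ∈ fv M → z′ ∈ fv M′ → ρ z ≡ ρ′ z′ → σ z ≡ σ′ z′) →
           M • σ ≡ M′ • σ′
  ⟦⟧≡⇒•≡ (con k) (con k′) eq h = cong con (conᵈ-injective eq)
  ⟦⟧≡⇒•≡ (var x) (var x′) eq h = h (here refl) (here refl) (varᵈ-injective eq)
  ⟦⟧≡⇒•≡ (M · N) (M′ · N′) eq h with appᵈ-injective eq
  ... | M≡ , N≡ = cong₂ _·_
    (⟦⟧≡⇒•≡ M M′ M≡ (λ z∈ z′∈ → h (∈-++⁺ˡ z∈) (∈-++⁺ˡ z′∈)))
    (⟦⟧≡⇒•≡ N N′ N≡ (λ z∈ z′∈ → h (∈-++⁺ʳ (fv M) z∈) (∈-++⁺ʳ (fv M′) z′∈)))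
  ⟦⟧≡⇒•≡ {ρ = ρ} {ρ′} {σ} {σ′} (Q [ x ∶ A ] M) (Q′ [ x′ ∶ A′ ] M′) eq h
    with bindᵈ-injective eq
  ... | refl , A≡ , M≡
    with ⟦⟧≡⇒•≡ A A′ A≡ (λ z∈ z′∈ → h (∈-++⁺ˡ z∈) (∈-++⁺ˡ z′∈))
       | X-cong {σ} {σ′} {fv M - x} {fv M′ - x′} images⊑ images⊒
    where
    agree : ∀ {z z′} → z ∈ fv M - x → z′ ∈ fv M′ - x′ → ρ z ≡ ρ′ z′ → σ z ≡ σ′ z′
    agree z∈ z′∈ = h (∈-++⁺ʳ (fv A) z∈) (∈-++⁺ʳ (fv A′) z′∈)

    images⊑ : ∀ {z} → z ∈ fv M - x → ∃ λ z′ → z′ ∈ fv M′ - x′ × σ z ≡ σ′ z′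
    images⊑ z∈ with fv-remove-⟦⟧ M M′ M≡ z∈
    ... | z′ , z′∈ , ρz≡ρ′z′ = z′ , z′∈ , agree z∈ z′∈ ρz≡ρ′z′

    images⊒ : ∀ {z′} → z′ ∈ fv M′ - x′ → ∃ λ z → z ∈ fv M - x × σ′ z′ ≡ σ z
    images⊒ z′∈ with fv-remove-⟦⟧ M′ M (sym M≡) z′∈
    ... | z , z∈ , ρ′z′≡ρz = z , z∈ , sym (agree z∈ z′∈ (sym ρ′z′≡ρz))
  -- Once the two chosen names are identified, both bodies receive the same variable for their bound
  -- one, and the induction hypothesis applies.
  ... | A•≡ | y≡y′ rewrite y≡y′ = cong₂ (Q [ _ ∶_]_) A•≡
    (⟦⟧≡⇒•≡ M M′ M≡ (λ z∈ z′∈ → ,:=-agree (var _) (λ z≢x z′≢x′ →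
      h (∈-fv-body Q A M z∈ z≢x) (∈-fv-body Q A′ M′ z′∈ z′≢x′))))

  -- The binder rule asks for syntactic identity of the renamed bodies, which `⟦⟧≡⇒•≡` yields for
  -- any name fresh for both. Recursion thus enters domains and applications only, and the
  -- environment stays `id`.
  ⟦⟧≡⇒∼α : ∀ M N → ⟦ M ⟧ id ≡ ⟦ N ⟧ id → M ∼α N
  ⟦⟧≡⇒∼α (con k) (con k′) refl = con
  ⟦⟧≡⇒∼α (var x) (var x′) refl = var
  ⟦⟧≡⇒∼α (M · N) (M′ · N′) eq with appᵈ-injective eq
  ... | M≡ , N≡ = app (⟦⟧≡⇒∼α M M′ M≡) (⟦⟧≡⇒∼α N N′ N≡)
  ⟦⟧≡⇒∼α (Q [ x ∶ A ] M) (Q′ [ x′ ∶ A′ ] M′) eq with bindᵈ-injective eq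
  ... | refl , A≡ , M≡ with firstNotIn ((fv M - x) ++ (fv M′ - x′))
  ...   | n , fresh , _ = bind (nth n) (⟦⟧≡⇒∼α A A′ A≡)
    (fresh ∘ ∈-++⁺ˡ) (fresh ∘ ∈-++⁺ʳ (fv M - x))
    (⟦⟧≡⇒•≡ M M′ M≡ λ _ _ → ,:=-agree (var (nth n)) λ _ _ → cong var)

  -- Simulation in both directions

  →β⇒⇛ : ∀ {M N} → M →β N → (ρ : V → I) → ⟦ M ⟧ ρ ⇛ ⟦ N ⟧ ρ
  →β⇒⇛ (step (β {x} {A} {M} {N})) ρ =
    subst (⟦ (ƛ [ x ∶ A ] M) · N ⟧ ρ ⇛_) (⟦⟧-[:=] ρ x M N) (⇛β (⇛-refl _) (⇛-refl _))
  →β⇒⇛ (appˡ r)   ρ = ⇛app (→β⇒⇛ r ρ) (⇛-refl _)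
  →β⇒⇛ (appʳ r)   ρ = ⇛app (⇛-refl _) (→β⇒⇛ r ρ)
  →β⇒⇛ (domain r) ρ = ⇛bind (→β⇒⇛ r ρ) (⇛-refl _)
  →β⇒⇛ (body r)   ρ = ⇛bind (⇛-refl _) (→β⇒⇛ r _)

  ↠β-app : ∀ {M M′ N N′} → M ↠β M′ → N ↠β N′ → M · N ↠β M′ · N′
  ↠β-app p q = Star.gmap (_· _) appˡ p ◅◅ Star.gmap (_ ·_) appʳ q

  ↠β-bind : ∀ {Q x A A′ M M′} → A ↠β A′ → M ↠β M′ → Q [ x ∶ A ] M ↠β Q [ x ∶ A′ ] M′
  ↠β-bind p q = Star.gmap (_ [ _ ∶_] _) domain p ◅◅ Star.gmap (_ [ _ ∶ _ ]_) body q

  -- A parallel contraction is realised by reducing body and argument first and contracting the raw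
  -- redex last. The resulting interpretation is exactly `d`, so no α-step intervenes.
  ⇛-lifts : ∀ M (ρ : V → I) {d} → ⟦ M ⟧ ρ ⇛ d → ∃ λ N → M ↠β N × ⟦ N ⟧ ρ ≡ d
  ⇛-lifts ((ƛ [ x ∶ A ] M) · N) ρ (⇛β p q) with ⇛-lifts M (ρ ▸ x) p | ⇛-lifts N ρ q
  ... | M′ , M↠ , refl | N′ , N↠ , refl =
    M′ [ x := N′ ] , ↠β-app (↠β-bind ε M↠) N↠ ◅◅ Star.return (step β) , sym (⟦⟧-[:=] ρ x M′ N′)
  ⇛-lifts (con k) ρ ⇛con = con k , ε , refl
  ⇛-lifts (var x) ρ ⇛var = var x , ε , refl
  ⇛-lifts (Q [ x ∶ A ] M) ρ (⇛bind p q) with ⇛-lifts A ρ p | ⇛-lifts M (ρ ▸ x) q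
  ... | A′ , A↠ , refl | M′ , M↠ , refl = Q [ x ∶ A′ ] M′ , ↠β-bind A↠ M↠ , refl
  ⇛-lifts (M · N) ρ (⇛app p q) with ⇛-lifts M ρ p | ⇛-lifts N ρ q
  ... | M′ , M↠ , refl | N′ , N↠ , refl = M′ · N′ , ↠β-app M↠ N↠ , refl

  ⇛*-lifts : ∀ M (ρ : V → I) {d} → Star _⇛_ (⟦ M ⟧ ρ) d → ∃ λ N → M ↠β N × ⟦ N ⟧ ρ ≡ d
  ⇛*-lifts M ρ ε = M , ε , refl
  ⇛*-lifts M ρ (p ◅ ps) with ⇛-lifts M ρ p
  ... | N , M↠N , refl with ⇛*-lifts N ρ ps
  ...   | P , N↠P , eq = P , M↠N ◅◅ N↠P , eq

  -- Joinability of interpretations and the Church-Rosser property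

  Joinable : Rel Λ (c ⊔ v)
  Joinable M N = ∃ λ d → Star _⇛_ (⟦ M ⟧ id) d × Star _⇛_ (⟦ N ⟧ id) d

  -- Transitivity is where confluence of parallel reduction enters: it closes the peak at the middle
  -- term.
  Joinable-isEquivalence : IsEquivalence Joinable
  Joinable-isEquivalence = record
    { refl  = _ , ε , ε
    ; sym   = λ (d , p , q) → d , q , p
    ; trans = λ (_ , p , q) (_ , p′ , q′) →
        let d , r , r′ = diamond⇒confluent ⇛-diamond q p′ in d , p ◅◅ r , q′ ◅◅ r′
    }

  -- It suffices to check generators: an α-step is an equality of interpretations, a β-step one
  -- parallel step.
  ≃β⇒Joinable : ∀ {M N} → M ≃β N → Joinable M N
  ≃β⇒Joinable = EqClosure.fold Joinable-isEquivalence λ where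
    (inj₁ M∼N) → _ , ε , subst (Star _⇛_ _) (sym (∼α⇒⟦⟧≡ M∼N id)) ε
    (inj₂ M→N) → _ , Star.return (→β⇒⇛ M→N id) , ε

  ≃β-church-rosser : ∀ M N → M ≃β N → ∃₂ λ P₁ P₂ → M ↠β P₁ × N ↠β P₂ × P₁ ∼α P₂
  ≃β-church-rosser M N M≃N with ≃β⇒Joinable M≃N
  ... | _ , p , q with ⇛*-lifts M id p | ⇛*-lifts N id q
  ...   | P₁ , M↠P₁ , P₁≡ | P₂ , N↠P₂ , P₂≡ =
          P₁ , P₂ , M↠P₁ , N↠P₂ , ⟦⟧≡⇒∼α P₁ P₂ (trans P₁≡ (sym P₂≡))

  -- Two reducts of `M` are β-convertible through `M`, so this is an instance of the statement for
  -- conversion.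
  ↠β-confluent : ∀ M N P → M ↠β N → M ↠β P → ∃₂ λ Q₁ Q₂ → N ↠β Q₁ × P ↠β Q₂ × Q₁ ∼α Q₂
  ↠β-confluent M N P M↠N M↠P =
    ≃β-church-rosser N P (EqClosure.map inj₂ (a—↠b&a—↠c⇒b↔c M↠N M↠P))

theorem1 : ∀ {c v} (C : Set c) (V : Set v) (_≟_ : DecidableEquality V) (enum : ℕ ↔ V) →
    let open Calculus C V _≟_ enum in
    (∀ (M N P : Λ) → M ↠β N → M ↠β P →
    ∃₂ λ (Q₁ Q₂ : Λ) → N ↠β Q₁ × P ↠β Q₂ × Q₁ ∼α Q₂)
    ×
    (∀ (M N : Λ) → M ≃β N →
    ∃₂ λ (P₁ P₂ : Λ) → M ↠β P₁ × N ↠β P₂ × P₁ ∼α P₂)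
theorem1 C V _≟_ enum = ↠β-confluent , ≃β-church-rosser
  where open ChurchRosser C V _≟_ enum
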